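{- For any $n\ge 1$, $$\sum_{\pi \in \mathfrak{S}_n} (-1)^{\mathrm{inv}(\pi)}\, \mathbf{x}_{\mathrm{RLMv}(\pi)} = \Big(\prod_{\substack{i \in [n] \\ i \text{ odd}}} x_i\Big)\Big(\prod_{\substack{j \in [n] \\ j \text{ even}}} (x_j-1)\Big).$$ In particular, for any $k=1,\dots,n$, $$|\{ \pi \in \mathfrak{S}^e_n : \mathrm{rlm}(\pi)=k \}| - |\{ \pi \in \mathfrak{S}^o_n : \mathrm{rlm}(\pi)=k \}| = (-1)^{n-k}\binom{ \lfloor n/2 \rfloor }{k - \lceil n/2 \rceil}.$$
   Context: $[n]=\{1,\dots,n\}$; $\mathfrak{S}_n$ is the symmetric group on $[n]$, with $\mathfrak{S}_n^e$ and $\mathfrak{S}_n^o$ the sets of even and odd permutations. For $\pi\in\mathfrak{S}_n$: $\mathrm{inv}(\pi)$ is the number of pairs $i<j$ with $\pi(i)>\pi(j)$; $\mathrm{RLMi}(\pi)=\{i\in[n]:\pi(i)<\pi(j)\text{ for all }j\in\{i+1,\dots,n\}\}$; $\mathrm{RLMv}(\pi)=\{\pi(i):i\in\mathrm{RLMi}(\pi)\}$; $\mathrm{rlm}(\pi)=|\mathrm{RLMv}(\pi)|$. $x_1,\dots,x_n$ are commuting indeterminates and $\mathbf{x}_S=\prod_{s\in S}x_s$. Binomial coefficients $\binom{a}{b}$ with $b<0$ or $b>a$ are $0$. -}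

module Defs where

open import Algebra.Bundles using (CommutativeRing)
import Algebra.Properties.Semiring.Exp as Exp
open import Data.Bool.Base using (if_then_else_)
open import Data.Fin.Base as Fin using (Fin; toℕ; fromℕ)
import Data.Fin.Permutation as Perm
open import Data.Fin.Permutation using (Permutation′; _⟨$⟩ʳ_; _⟨$⟩ˡ_; insert; remove)
import Data.Fin.Properties as Fin
open import Data.Fin.Subset using (Subset; _∈_; ∣_∣)
open import Data.Fin.Subset.Properties using (_∈?_)
open import Data.Integer.Base as ℤ using (ℤ; +_; -[1+_])
import Data.Integer.Properties as ℤ
open import Data.Integer.Tactic.RingSolver using (solve-∀)
open import Data.List.Base
  using (List; []; _∷_; _++_; map; foldr; filter; length; allFin; cartesianProduct; cartesianProductWith)
import Data.List.Properties as List
open import Data.List.Membership.Setoid using () renaming (_∈_ to _∈ₗ_)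
open import Data.List.Membership.Propositional.Properties using (∈-allFin)
open import Data.List.Membership.Setoid.Properties using (∈-cartesianProductWith⁺; ∈-resp-≈)
open import Data.List.Relation.Unary.All using ([])
open import Data.List.Relation.Unary.AllPairs using ([]; _∷_)
open import Data.List.Relation.Unary.Any using (here)
open import Data.List.Relation.Unary.Unique.Setoid using (Unique)
import Data.List.Relation.Unary.Unique.Setoid.Properties as Unique
import Data.List.Relation.Unary.Unique.Propositional.Properties as Uniqueₚ
open import Data.Nat.Base as ℕ using (ℕ; zero; suc)
open import Data.Nat.Combinatorics using (_C_)
open import Data.Nat.Divisibility as ℕ using (_∣_; _∣?_)
import Data.Nat.Properties as ℕ
open import Data.Product.Base using (_×_; _,_; proj₁; proj₂; ∃)
open import Data.Vec.Base as Vec using (Vec; tabulate; replicate; zipWith; _[_]≔_)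
import Data.Vec.Properties as Vec
open import Level using (0ℓ)
open import Relation.Binary.Bundles using (Setoid)
open import Relation.Binary.Definitions using (DecidableEquality)
open import Relation.Binary.PropositionalEquality
open import Relation.Nullary using (¬_; Dec; yes; no; does; contradiction; ¬?)
open import Relation.Nullary.Decidable using (_×-dec_; _→-dec_)
open import Relation.Unary using (Pred; Decidable)

private
  variable
    n : ℕ

-- Position and letter i + 1 of [n] are represented by the element of
-- Fin n whose toℕ is i.

-- All permutations: put the greatest letter at any position of any
-- smaller permutation.
𝔖 : ∀ n → List (Permutation′ n)
𝔖 zero    = Perm.id ∷ []
𝔖 (suc n) = cartesianProductWith (λ i π → insert i (fromℕ n) π) (allFin (suc n)) (𝔖 n)

-- 𝔖 n lists every permutation exactly once, with permutations compared
-- as functions (the inverse carried by Permutation′ is irrelevant).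
permutationSetoid : ℕ → Setoid 0ℓ 0ℓ
permutationSetoid n = record
  { Carrier       = Permutation′ n
  ; _≈_           = Perm._≈_
  ; isEquivalence = record
    { refl  = λ _ → refl
    ; sym   = λ eq i → sym (eq i)
    ; trans = λ eq₁ eq₂ i → trans (eq₁ i) (eq₂ i)
    }
  }

private
  insert-at : ∀ i j (π : Permutation′ n) → insert i j π ⟨$⟩ʳ i ≡ j
  insert-at i j π with i Fin.≟ i
  ... | yes _   = refl
  ... | no  i≢i = contradiction refl i≢i

  insert-cong : ∀ i j {π ρ : Permutation′ n} → π Perm.≈ ρ → insert i j π Perm.≈ insert i j ρ
  insert-cong i j π≈ρ k with i Fin.≟ k
  ... | yes _ = refl
  ... | no  _ = cong (Fin.punchIn j) (π≈ρ _)

  insert-injective : ∀ {i i′ j} {π ρ : Permutation′ n} →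
                     insert i j π Perm.≈ insert i′ j ρ → i ≡ i′ × π Perm.≈ ρ
  insert-injective {i = i} {i′} {j} {π} {ρ} eq = i≡i′ , π≈ρ
    where
    σ = insert i′ j ρ

    i≡i′ : i ≡ i′
    i≡i′ = begin
      i                   ≡⟨ Perm.inverseˡ σ ⟨
      σ ⟨$⟩ˡ (σ ⟨$⟩ʳ i)   ≡⟨ cong (σ ⟨$⟩ˡ_) (eq i) ⟨
      σ ⟨$⟩ˡ (insert i j π ⟨$⟩ʳ i) ≡⟨ cong (σ ⟨$⟩ˡ_) (insert-at i j π) ⟩
      σ ⟨$⟩ˡ j            ≡⟨ cong (σ ⟨$⟩ˡ_) (insert-at i′ j ρ) ⟨
      σ ⟨$⟩ˡ (σ ⟨$⟩ʳ i′)  ≡⟨ Perm.inverseˡ σ ⟩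
      i′                  ∎
      where open ≡-Reasoning

    π≈ρ : π Perm.≈ ρ
    π≈ρ k = Fin.punchIn-injective j _ _ (begin
      Fin.punchIn j (π ⟨$⟩ʳ k)                  ≡⟨ Perm.insert-punchIn i j π k ⟨
      insert i j π ⟨$⟩ʳ Fin.punchIn i k         ≡⟨ eq _ ⟩
      insert i′ j ρ ⟨$⟩ʳ Fin.punchIn i k        ≡⟨ cong (λ l → σ ⟨$⟩ʳ Fin.punchIn l k) i≡i′ ⟩
      insert i′ j ρ ⟨$⟩ʳ Fin.punchIn i′ k       ≡⟨ Perm.insert-punchIn i′ j ρ k ⟩
      Fin.punchIn j (ρ ⟨$⟩ʳ k)                  ∎)
      where open ≡-Reasoning

𝔖-complete : (π : Permutation′ n) → _∈ₗ_ (permutationSetoid n) π (𝔖 n)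
𝔖-complete {zero}  π = here λ ()
𝔖-complete {suc n} π =
  ∈-resp-≈ (permutationSetoid (suc n)) {𝔖 (suc n)} {insert i (fromℕ n) (remove i π)} {π} eq
    (∈-cartesianProductWith⁺ (setoid _) (permutationSetoid n) (permutationSetoid (suc n))
      {f = λ j ρ → insert j (fromℕ n) ρ}
      (λ { {j} {_} {ρ} {σ} refl ρ≈σ → insert-cong j (fromℕ n) {ρ} {σ} ρ≈σ })
      (∈-allFin i) (𝔖-complete (remove i π)))
  where
  i = π ⟨$⟩ˡ fromℕ n

  eq : insert i (fromℕ n) (remove i π) Perm.≈ π
  eq = subst (λ j → insert i j (remove i π) Perm.≈ π) (Perm.inverseʳ π) (Perm.insert-remove i π)

𝔖-unique : ∀ n → Unique (permutationSetoid n) (𝔖 n)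
𝔖-unique zero    = [] ∷ []
𝔖-unique (suc n) =
  Unique.cartesianProductWith⁺ (setoid _) (permutationSetoid n) (permutationSetoid (suc n)) _
    (λ {_} {_} {π} {ρ} → insert-injective {π = π} {ρ}) (Uniqueₚ.allFin⁺ (suc n)) (𝔖-unique n)

Inversion : Permutation′ n → Pred (Fin n × Fin n) 0ℓ
Inversion π (i , j) = i Fin.< j × π ⟨$⟩ʳ j Fin.< π ⟨$⟩ʳ i

inversion? : (π : Permutation′ n) → Decidable (Inversion π)
inversion? π (i , j) = (i Fin.<? j) ×-dec (π ⟨$⟩ʳ j Fin.<? π ⟨$⟩ʳ i)

inv : Permutation′ n → ℕ
inv {n} π = length (filter (inversion? π) (cartesianProduct (allFin n) (allFin n)))

subset : {P : Pred (Fin n) 0ℓ} → Decidable P → Subset n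
subset P? = tabulate (λ i → does (P? i))

IsRLMi : Permutation′ n → Pred (Fin n) 0ℓ
IsRLMi π i = ∀ j → i Fin.< j → π ⟨$⟩ʳ i Fin.< π ⟨$⟩ʳ j

isRLMi? : (π : Permutation′ n) → Decidable (IsRLMi π)
isRLMi? π i = Fin.all? λ j → (i Fin.<? j) →-dec (π ⟨$⟩ʳ i Fin.<? π ⟨$⟩ʳ j)

RLMi : Permutation′ n → Subset n
RLMi π = subset (isRLMi? π)

IsRLMv : Permutation′ n → Pred (Fin n) 0ℓ
IsRLMv π v = ∃ λ i → i ∈ RLMi π × π ⟨$⟩ʳ i ≡ v

isRLMv? : (π : Permutation′ n) → Decidable (IsRLMv π)
isRLMv? π v = Fin.any? λ i → (i ∈? RLMi π) ×-dec (π ⟨$⟩ʳ i Fin.≟ v)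

RLMv : Permutation′ n → Subset n
RLMv π = subset (isRLMv? π)

rlm : Permutation′ n → ℕ
rlm π = ∣ RLMv π ∣

Even : ℕ → Set
Even m = 2 ∣ m

even? : Decidable Even
even? m = 2 ∣? m

Odd : ℕ → Set
Odd m = ¬ Even m

odd? : Decidable Odd
odd? m = ¬? (even? m)

𝔖ᵉ 𝔖ᵒ : ∀ n → List (Permutation′ n)
𝔖ᵉ n = filter (λ π → even? (inv π)) (𝔖 n)
𝔖ᵒ n = filter (λ π → odd?  (inv π)) (𝔖 n)

evens odds : ∀ n → Subset n
evens n = subset (λ i → even? (suc (toℕ i)))
odds  n = subset (λ i → odd?  (suc (toℕ i)))

-- The binomial coefficient with an integer lower index; _C_ already
-- vanishes when the lower index exceeds the upper one.
binomial : ℕ → ℤ → ℕ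
binomial a (+ b)    = a C b
binomial a -[1+ _ ] = 0

-- In ℤ[x₁, …, xₙ] a monomial is its vector of exponents, a polynomial is a finite formal
-- sum of terms, and polynomials are equal when all coefficients agree.

Monomial : ℕ → Set
Monomial n = Vec ℕ n

infixl 7 _∙_
_∙_ : Monomial n → Monomial n → Monomial n
_∙_ = zipWith ℕ._+_

_≟ₘ_ : DecidableEquality (Monomial n)
_≟ₘ_ = Vec.≡-dec ℕ._≟_

Term : ℕ → Set
Term n = ℤ × Monomial n

Poly : ℕ → Set
Poly n = List (Term n)

termCoeff : Term n → Monomial n → ℤ
termCoeff (c , m) e = if does (m ≟ₘ e) then c else ℤ.0ℤ

coeff : Poly n → Monomial n → ℤ
coeff []      e = ℤ.0ℤ
coeff (t ∷ p) e = termCoeff t e ℤ.+ coeff p e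

infix 4 _≈ₚ_
record _≈ₚ_ (p q : Poly n) : Set where
  constructor mk≈
  field
    coeff-≡ : ∀ e → coeff p e ≡ coeff q e

open _≈ₚ_ public

0ₚ 1ₚ : Poly n
0ₚ = []
1ₚ = (ℤ.1ℤ , replicate _ 0) ∷ []

var : Fin n → Poly n
var i = (ℤ.1ℤ , replicate _ 0 [ i ]≔ 1) ∷ []

infixl 7 _*ₜ_ _*ₚ_
infixl 6 _+ₚ_ _-ₚ_
infix  8 -ₚ_

_+ₚ_ : Poly n → Poly n → Poly n
_+ₚ_ = _++_

_*ₜ_ : Term n → Term n → Term n
(c , m) *ₜ (d , l) = c ℤ.* d , m ∙ l

_*ₚ_ : Poly n → Poly n → Poly n
_*ₚ_ = cartesianProductWith _*ₜ_

-ₚ_ : Poly n → Poly n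
-ₚ_ = map λ { (c , m) → ℤ.- c , m }

private
  coeff-+ : ∀ (p q : Poly n) e → coeff (p +ₚ q) e ≡ coeff p e ℤ.+ coeff q e
  coeff-+ []      q e = sym (ℤ.+-identityˡ _)
  coeff-+ (t ∷ p) q e = trans (cong (λ z → termCoeff t e ℤ.+ z) (coeff-+ p q e))
                              (sym (ℤ.+-assoc (termCoeff t e) _ _))

  coeff-neg : ∀ (p : Poly n) e → coeff (-ₚ p) e ≡ ℤ.- coeff p e
  coeff-neg []            e = refl
  coeff-neg ((c , m) ∷ p) e with m ≟ₘ e
  ... | yes _ = trans (cong (λ z → ℤ.- c ℤ.+ z) (coeff-neg p e)) (sym (ℤ.neg-distrib-+ c (coeff p e)))
  ... | no  _ = trans (cong (λ z → ℤ.0ℤ ℤ.+ z) (coeff-neg p e)) (sym (ℤ.neg-distrib-+ ℤ.0ℤ (coeff p e)))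

  ∙-assoc : ∀ (m l k : Monomial n) → (m ∙ l) ∙ k ≡ m ∙ (l ∙ k)
  ∙-assoc = Vec.zipWith-assoc ℕ.+-assoc

  ∙-comm : ∀ (m l : Monomial n) → m ∙ l ≡ l ∙ m
  ∙-comm = Vec.zipWith-comm ℕ.+-comm

  ∙-identityˡ : ∀ (m : Monomial n) → replicate n 0 ∙ m ≡ m
  ∙-identityˡ = Vec.zipWith-identityˡ ℕ.+-identityˡ

  ∙-cancelˡ : ∀ (m : Monomial n) {l k} → m ∙ l ≡ m ∙ k → l ≡ k
  ∙-cancelˡ Vec.[]      {Vec.[]}    {Vec.[]}    _  = refl
  ∙-cancelˡ (a Vec.∷ m) {b Vec.∷ l} {c Vec.∷ k} eq with Vec.∷-injective eq
  ... | eq₁ , eq₂ = cong₂ Vec._∷_ (ℕ.+-cancelˡ-≡ a b c eq₁) (∙-cancelˡ m eq₂)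

  divides? : (m e : Monomial n) → Dec (∃ λ d → m ∙ d ≡ e)
  divides? Vec.[]      Vec.[]      = yes (Vec.[] , refl)
  divides? (a Vec.∷ m) (b Vec.∷ e) with a ℕ.≤? b | divides? m e
  ... | yes a≤b | yes (d , eq) = yes ((b ℕ.∸ a) Vec.∷ d , cong₂ Vec._∷_ (ℕ.m+[n∸m]≡n a≤b) eq)
  ... | no  a≰b | _            = no λ { (x Vec.∷ _ , eq) →
    a≰b (subst (a ℕ.≤_) (proj₁ (Vec.∷-injective eq)) (ℕ.m≤m+n a x)) }
  ... | yes _   | no ¬d        = no λ { (_ Vec.∷ d , eq) → ¬d (d , proj₂ (Vec.∷-injective eq)) }

  coeff-term* : ∀ c (m d : Monomial n) q → coeff (map ((c , m) *ₜ_) q) (m ∙ d) ≡ c ℤ.* coeff q d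
  coeff-term* c m d []            = sym (ℤ.*-zeroʳ c)
  coeff-term* c m d ((b , l) ∷ q) with l ≟ₘ d | (m ∙ l) ≟ₘ (m ∙ d)
  ... | yes _   | yes _  = trans (cong (λ z → c ℤ.* b ℤ.+ z) (coeff-term* c m d q)) (sym (ℤ.*-distribˡ-+ c b (coeff q d)))
  ... | yes l≡d | no neq = contradiction (cong (m ∙_) l≡d) neq
  ... | no  l≢d | yes eq = contradiction (∙-cancelˡ m eq) l≢d
  ... | no  _   | no _   = trans (ℤ.+-identityˡ _) (trans (coeff-term* c m d q) (cong (c ℤ.*_) (sym (ℤ.+-identityˡ (coeff q d)))))

  coeff-term*-∤ : ∀ c (m e : Monomial n) q → ¬ (∃ λ d → m ∙ d ≡ e) → coeff (map ((c , m) *ₜ_) q) e ≡ ℤ.0ℤ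
  coeff-term*-∤ c m e []            ¬d = refl
  coeff-term*-∤ c m e ((b , l) ∷ q) ¬d with (m ∙ l) ≟ₘ e
  ... | yes eq = contradiction (l , eq) ¬d
  ... | no  _  = trans (ℤ.+-identityˡ _) (coeff-term*-∤ c m e q ¬d)

  term*-cong : ∀ (t : Term n) {q q′} → q ≈ₚ q′ → ∀ e → coeff (map (t *ₜ_) q) e ≡ coeff (map (t *ₜ_) q′) e
  term*-cong (c , m) {q} {q′} q≈q′ e with divides? m e
  ... | yes (d , refl) = trans (coeff-term* c m d q) (trans (cong (c ℤ.*_) (coeff-≡ q≈q′ d)) (sym (coeff-term* c m d q′)))
  ... | no  ¬d         = trans (coeff-term*-∤ c m e q ¬d) (sym (coeff-term*-∤ c m e q′ ¬d))

  *-congˡ : ∀ (p : Poly n) {q q′} → q ≈ₚ q′ → ∀ e → coeff (p *ₚ q) e ≡ coeff (p *ₚ q′) e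
  *-congˡ []      q≈q′ e = refl
  *-congˡ (t ∷ p) {q} {q′} q≈q′ e = begin
    coeff (map (t *ₜ_) q ++ p *ₚ q) e                ≡⟨ coeff-+ (map (t *ₜ_) q) _ e ⟩
    coeff (map (t *ₜ_) q) e ℤ.+ coeff (p *ₚ q) e     ≡⟨ cong₂ ℤ._+_ (term*-cong t q≈q′ e) (*-congˡ p q≈q′ e) ⟩
    coeff (map (t *ₜ_) q′) e ℤ.+ coeff (p *ₚ q′) e   ≡⟨ coeff-+ (map (t *ₜ_) q′) _ e ⟨
    coeff (map (t *ₜ_) q′ ++ p *ₚ q′) e              ∎
    where open ≡-Reasoning

  *ₜ-comm : ∀ (t u : Term n) → t *ₜ u ≡ u *ₜ t
  *ₜ-comm (c , m) (d , l) = cong₂ _,_ (ℤ.*-comm c d) (∙-comm m l)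

  *ₜ-assoc : ∀ (t u v : Term n) → (t *ₜ u) *ₜ v ≡ t *ₜ (u *ₜ v)
  *ₜ-assoc (c , m) (d , l) (b , k) = cong₂ _,_ (ℤ.*-assoc c d b) (∙-assoc m l k)

  coeff-*∷ : ∀ (p : Poly n) t q e → coeff (p *ₚ (t ∷ q)) e ≡ coeff (map (t *ₜ_) p) e ℤ.+ coeff (p *ₚ q) e
  coeff-*∷ []      t q e = refl
  coeff-*∷ (u ∷ p) t q e = begin
    termCoeff (u *ₜ t) e ℤ.+ coeff (map (u *ₜ_) q ++ p *ₚ (t ∷ q)) e
      ≡⟨ cong₂ (λ v z → termCoeff v e ℤ.+ z) (*ₜ-comm u t)
           (trans (coeff-+ (map (u *ₜ_) q) _ e) (cong (λ z → coeff (map (u *ₜ_) q) e ℤ.+ z) (coeff-*∷ p t q e))) ⟩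
    termCoeff (t *ₜ u) e ℤ.+ (coeff (map (u *ₜ_) q) e ℤ.+ (coeff (map (t *ₜ_) p) e ℤ.+ coeff (p *ₚ q) e))
      ≡⟨ rearrange (termCoeff (t *ₜ u) e) (coeff (map (u *ₜ_) q) e) _ _ ⟩
    (termCoeff (t *ₜ u) e ℤ.+ coeff (map (t *ₜ_) p) e) ℤ.+ (coeff (map (u *ₜ_) q) e ℤ.+ coeff (p *ₚ q) e)
      ≡⟨ cong (λ z → (termCoeff (t *ₜ u) e ℤ.+ coeff (map (t *ₜ_) p) e) ℤ.+ z) (sym (coeff-+ (map (u *ₜ_) q) _ e)) ⟩
    (termCoeff (t *ₜ u) e ℤ.+ coeff (map (t *ₜ_) p) e) ℤ.+ coeff (map (u *ₜ_) q ++ p *ₚ q) e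
      ∎
    where
    open ≡-Reasoning
    rearrange : ∀ a b c d → a ℤ.+ (b ℤ.+ (c ℤ.+ d)) ≡ (a ℤ.+ c) ℤ.+ (b ℤ.+ d)
    rearrange = solve-∀

  *-comm′ : ∀ (p q : Poly n) e → coeff (p *ₚ q) e ≡ coeff (q *ₚ p) e
  *-comm′ []      q e = cong (λ r → coeff r e) (sym (List.cartesianProductWith-zeroʳ _*ₜ_ q))
  *-comm′ (t ∷ p) q e = begin
    coeff (map (t *ₜ_) q ++ p *ₚ q) e               ≡⟨ coeff-+ (map (t *ₜ_) q) _ e ⟩
    coeff (map (t *ₜ_) q) e ℤ.+ coeff (p *ₚ q) e    ≡⟨ cong (λ z → coeff (map (t *ₜ_) q) e ℤ.+ z) (*-comm′ p q e) ⟩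
    coeff (map (t *ₜ_) q) e ℤ.+ coeff (q *ₚ p) e    ≡⟨ coeff-*∷ q t p e ⟨
    coeff (q *ₚ (t ∷ p)) e                          ∎
    where open ≡-Reasoning

  map-*ₚ : ∀ (t : Term n) q r → map (t *ₜ_) (q *ₚ r) ≡ map (t *ₜ_) q *ₚ r
  map-*ₚ t []      r = refl
  map-*ₚ t (u ∷ q) r = trans (List.map-++ (t *ₜ_) (map (u *ₜ_) r) (q *ₚ r))
    (cong₂ _++_ (trans (sym (List.map-∘ r)) (List.map-cong (λ v → sym (*ₜ-assoc t u v)) r)) (map-*ₚ t q r))

  *-assoc′ : ∀ (p q r : Poly n) → (p *ₚ q) *ₚ r ≡ p *ₚ (q *ₚ r)
  *-assoc′ []      q r = refl
  *-assoc′ (t ∷ p) q r = trans (List.cartesianProductWith-distribʳ-++ _*ₜ_ (map (t *ₜ_) q) (p *ₚ q) r)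
    (cong₂ _++_ (sym (map-*ₚ t q r)) (*-assoc′ p q r))

  *-identityˡ′ : ∀ (p : Poly n) → 1ₚ *ₚ p ≡ p
  *-identityˡ′ p = trans (List.++-identityʳ _)
    (trans (List.map-cong (λ { (c , m) → cong₂ _,_ (ℤ.*-identityˡ c) (∙-identityˡ m) }) p) (List.map-id p))

  ≈-reflexive : ∀ {p q : Poly n} → p ≡ q → p ≈ₚ q
  ≈-reflexive refl = mk≈ λ _ → refl

  ≈-trans : ∀ {p q r : Poly n} → p ≈ₚ q → q ≈ₚ r → p ≈ₚ r
  ≈-trans p≈q q≈r = mk≈ λ e → trans (coeff-≡ p≈q e) (coeff-≡ q≈r e)

  +-cong′ : ∀ {p p′ q q′ : Poly n} → p ≈ₚ p′ → q ≈ₚ q′ → p +ₚ q ≈ₚ p′ +ₚ q′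
  +-cong′ {p = p} {p′} {q} {q′} p≈ q≈ = mk≈ λ e →
    trans (coeff-+ p q e) (trans (cong₂ ℤ._+_ (coeff-≡ p≈ e) (coeff-≡ q≈ e)) (sym (coeff-+ p′ q′ e)))

  +-comm′ : ∀ (p q : Poly n) → p +ₚ q ≈ₚ q +ₚ p
  +-comm′ p q = mk≈ λ e → trans (coeff-+ p q e) (trans (ℤ.+-comm (coeff p e) _) (sym (coeff-+ q p e)))

  *-commₚ : ∀ (p q : Poly n) → p *ₚ q ≈ₚ q *ₚ p
  *-commₚ p q = mk≈ (*-comm′ p q)

  *-cong′ : ∀ {p p′ q q′ : Poly n} → p ≈ₚ p′ → q ≈ₚ q′ → p *ₚ q ≈ₚ p′ *ₚ q′
  *-cong′ {p = p} {p′} {q} {q′} p≈ q≈ =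
    ≈-trans (mk≈ (*-congˡ p q≈)) (≈-trans (*-commₚ p q′) (≈-trans (mk≈ (*-congˡ q′ p≈)) (*-commₚ q′ p′)))

  neg-cong : ∀ {p q : Poly n} → p ≈ₚ q → -ₚ p ≈ₚ -ₚ q
  neg-cong {p = p} {q} p≈q = mk≈ λ e →
    trans (coeff-neg p e) (trans (cong ℤ.-_ (coeff-≡ p≈q e)) (sym (coeff-neg q e)))

  neg-inverseˡ : ∀ (p : Poly n) → -ₚ p +ₚ p ≈ₚ 0ₚ
  neg-inverseˡ p = mk≈ λ e → trans (coeff-+ (-ₚ p) p e)
    (trans (cong (ℤ._+ coeff p e) (coeff-neg p e)) (ℤ.+-inverseˡ (coeff p e)))

  distribʳ′ : ∀ (r p q : Poly n) → (p +ₚ q) *ₚ r ≈ₚ p *ₚ r +ₚ q *ₚ r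
  distribʳ′ r p q = ≈-reflexive (List.cartesianProductWith-distribʳ-++ _*ₜ_ p q r)

  distribˡ′ : ∀ (r p q : Poly n) → r *ₚ (p +ₚ q) ≈ₚ r *ₚ p +ₚ r *ₚ q
  distribˡ′ r p q = ≈-trans (*-commₚ r (p +ₚ q)) (≈-trans (distribʳ′ r p q) (+-cong′ (*-commₚ p r) (*-commₚ q r)))

ℤ[𝐱] : ℕ → CommutativeRing 0ℓ 0ℓ
ℤ[𝐱] n = record
  { Carrier = Poly n
  ; _≈_     = _≈ₚ_
  ; _+_     = _+ₚ_
  ; _*_     = _*ₚ_
  ; -_      = -ₚ_
  ; 0#      = 0ₚ
  ; 1#      = 1ₚ
  ; isCommutativeRing = record
    { isRing = record
      { +-isAbelianGroup = record
        { isGroup = record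
          { isMonoid = record
            { isSemigroup = record
              { isMagma = record
                { isEquivalence = record
                  { refl  = ≈-reflexive refl
                  ; sym   = λ p≈q → mk≈ λ e → sym (coeff-≡ p≈q e)
                  ; trans = ≈-trans
                  }
                ; ∙-cong = +-cong′
                }
              ; assoc = λ p q r → ≈-reflexive (List.++-assoc p q r)
              }
            ; identity = (λ _ → ≈-reflexive refl) , (λ p → ≈-reflexive (List.++-identityʳ p))
            }
          ; inverse = neg-inverseˡ , (λ p → ≈-trans (+-comm′ p (-ₚ p)) (neg-inverseˡ p))
          ; ⁻¹-cong = neg-cong
          }
        ; comm = +-comm′
        }
      ; *-cong     = *-cong′
      ; *-assoc    = λ p q r → ≈-reflexive (*-assoc′ p q r)
      ; *-identity = (λ p → ≈-reflexive (*-identityˡ′ p))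
                   , (λ p → ≈-trans (*-commₚ p 1ₚ) (≈-reflexive (*-identityˡ′ p)))
      ; distrib    = distribˡ′ , distribʳ′
      }
    ; *-comm = *-commₚ
    }
  }

_-ₚ_ : Poly n → Poly n → Poly n
_-ₚ_ {n} = CommutativeRing._-_ (ℤ[𝐱] n)

infixr 8 _^ₚ_
_^ₚ_ : Poly n → ℕ → Poly n
_^ₚ_ {n} = Exp._^_ (CommutativeRing.semiring (ℤ[𝐱] n))

infix 5 ∑ ∏

∑ : {A : Set} → List A → (A → Poly n) → Poly n
∑ xs f = foldr (λ a s → f a +ₚ s) 0ₚ xs

∏ : Subset n → (Fin n → Poly n) → Poly n
∏ {n} S f = foldr (λ i p → f i *ₚ p) 1ₚ (filter (_∈? S) (allFin n))

syntax ∑ xs (λ a → t) = ∑[ a ← xs ] t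
syntax ∏ S (λ i → t) = ∏[ i ∈ S ] t

𝐱 : Subset n → Poly n
𝐱 S = ∏[ s ∈ S ] var s

{-# OPTIONS --safe #-}
-- Every permutation of [n + 1] arises from a unique π ∈ 𝔖ₙ by inserting the letter n + 1 at some
-- position i. The insertion creates n + 1 - i inversions, and n + 1 becomes a right-to-left minimum
-- exactly when i = n + 1, while all other right-to-left minimum values stay the same. Hence the
-- signed sum is multiplied by x_{n+1} + ∑_{i ≤ n} (-1)^{n+1-i}, which is x_{n+1} - 1 if n + 1 is even
-- and x_{n+1} if n + 1 is odd. The same recursion with values in ℤ, weighting π by [rlm π = k],
-- becomes Pascal's rule for the second identity.
module Submission where

open import Defs
open import Data.Integer.Base using (+_; -1ℤ; _⊖_) renaming (_-_ to _-ℤ_; _*_ to _*ℤ_; _^_ to _^ℤ_)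
open import Data.List.Base using (length; filter)
open import Data.Nat.Base using (ℕ; _≤_; _≥_; _∸_; ⌊_/2⌋; ⌈_/2⌉)
open import Data.Nat.Properties using (_≟_)
open import Data.Product.Base using (_×_)
open import Relation.Binary.PropositionalEquality using (_≡_)

open import Algebra.Bundles using (CommutativeMonoid; CommutativeRing)
import Algebra.Properties.CommutativeMonoid.Sum as Sum
import Algebra.Properties.CommutativeSemigroup as CommutativeSemigroupProperties
import Algebra.Properties.Ring as RingProperties
import Algebra.Properties.Semiring.Exp as Exp
import Algebra.Properties.Semiring.Sum as SemiringSum
open import Data.Bool.Base using (Bool; true; false; not; if_then_else_)
open import Data.Fin.Base as Fin using (Fin; zero; suc; toℕ; fromℕ; inject₁; punchIn; punchOut)
open import Data.Fin.Permutation using (Permutation′; _⟨$⟩ʳ_; insert; insert-punchIn)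
import Data.Fin.Properties as Fin
open import Data.Fin.Subset using (Subset; _∈_; ∣_∣)
open import Data.Fin.Subset.Properties using (_∈?_)
open import Data.Integer.Base as ℤ using (ℤ; 0ℤ; 1ℤ)
import Data.Integer.Properties as ℤ
open import Data.Integer.Tactic.RingSolver using (solve-∀)
open import Data.List.Base
  using (List; []; _∷_; _++_; map; foldr; allFin; tabulate; cartesianProduct; cartesianProductWith)
open import Data.Nat.Base as ℕ using (zero; suc; z≤n)
open import Data.Nat.Combinatorics using (_C_; nCn≡1; nCk≡nC[n∸k]; nCk+nC[k+1]≡[n+1]C[k+1])
import Data.Nat.Divisibility as ℕ
import Data.Nat.Properties as ℕ
open import Data.Product.Base using (_,_; proj₁; proj₂)
open import Data.Sum.Base using (_⊎_; inj₁; inj₂)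
open import Data.Vec.Base as Vec using (lookup; _∷ʳ_)
import Data.Vec.Properties as Vec
open import Function.Base using (_∘_; id)
open import Function.Bundles using (_⇔_; mk⇔; Equivalence)
open import Level using (0ℓ)
open import Relation.Binary.PropositionalEquality
  using (refl; sym; trans; cong; cong₂; subst; module ≡-Reasoning)
import Relation.Binary.Reasoning.Setoid as SetoidReasoning
open import Relation.Nullary using (¬_; Dec; yes; no; does; contradiction; ¬?)
open import Relation.Nullary.Decidable using (dec-true; dec-false; does-⇔)
open import Relation.Unary using (Pred; Decidable)

private
  variable
    n : ℕ

open Equivalence using (to; from)

-- Sums over lists in a commutative monoid.

module ListSum {c ℓ} (M : CommutativeMonoid c ℓ) where

  open CommutativeMonoid M renaming (_∙_ to _⊕_; refl to ≈-refl; sym to ≈-sym; trans to ≈-trans)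
  open Sum M using (sum)
  open CommutativeSemigroupProperties commutativeSemigroup using (interchange)

  private
    variable
      A B C : Set

  -- The monoid is left open because counts in ℕ, sums in a ring and products in a ring are all
  -- needed; `∑` and `∏` unfold to the same `foldr`.
  ⨁ : List A → (A → Carrier) → Carrier
  ⨁ xs f = foldr (λ x s → f x ⊕ s) ε xs

  ⨁-cong : ∀ (xs : List A) {f g} → (∀ x → f x ≈ g x) → ⨁ xs f ≈ ⨁ xs g
  ⨁-cong []       f≈g = ≈-refl
  ⨁-cong (x ∷ xs) f≈g = ∙-cong (f≈g x) (⨁-cong xs f≈g)

  ⨁-ε : ∀ (xs : List A) → ⨁ xs (λ _ → ε) ≈ ε
  ⨁-ε []       = ≈-refl
  ⨁-ε (x ∷ xs) = ≈-trans (identityˡ _) (⨁-ε xs)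

  ⨁-∙ : ∀ (xs : List A) f g → ⨁ xs (λ x → f x ⊕ g x) ≈ ⨁ xs f ⊕ ⨁ xs g
  ⨁-∙ []       f g = ≈-sym (identityˡ ε)
  ⨁-∙ (x ∷ xs) f g = ≈-trans (∙-congˡ (⨁-∙ xs f g)) (interchange _ _ _ _)

  ⨁-swap : ∀ (xs : List A) (ys : List B) (f : A → B → Carrier) →
           ⨁ xs (λ x → ⨁ ys (λ y → f x y)) ≈ ⨁ ys (λ y → ⨁ xs (λ x → f x y))
  ⨁-swap []       ys f = ≈-sym (⨁-ε ys)
  ⨁-swap (x ∷ xs) ys f = ≈-trans (∙-congˡ (⨁-swap xs ys f)) (≈-sym (⨁-∙ ys _ _))

  ⨁-map-++ : ∀ (g : A → B) xs ys f → ⨁ (map g xs ++ ys) f ≈ ⨁ xs (f ∘ g) ⊕ ⨁ ys f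
  ⨁-map-++ g []       ys f = ≈-sym (identityˡ _)
  ⨁-map-++ g (x ∷ xs) ys f = ≈-trans (∙-congˡ (⨁-map-++ g xs ys f)) (≈-sym (assoc _ _ _))

  ⨁-cartesianProductWith : ∀ (h : A → B → C) xs ys (f : C → Carrier) →
    ⨁ (cartesianProductWith h xs ys) f ≈ ⨁ xs (λ x → ⨁ ys (λ y → f (h x y)))
  ⨁-cartesianProductWith h []       ys f = ≈-refl
  ⨁-cartesianProductWith h (x ∷ xs) ys f =
    ≈-trans (⨁-map-++ (h x) ys _ f) (∙-congˡ (⨁-cartesianProductWith h xs ys f))

  ⨁-filter : ∀ {P : Pred A 0ℓ} (P? : Decidable P) xs f →
             ⨁ (filter P? xs) f ≈ ⨁ xs (λ x → if does (P? x) then f x else ε)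
  ⨁-filter P? []       f = ≈-refl
  ⨁-filter P? (x ∷ xs) f with does (P? x)
  ... | true  = ∙-congˡ (⨁-filter P? xs f)
  ... | false = ≈-trans (⨁-filter P? xs f) (≈-sym (identityˡ _))

  ⨁-tabulate : ∀ {n} (g : Fin n → A) f → ⨁ (tabulate g) f ≈ sum (f ∘ g)
  ⨁-tabulate {n = zero}  g f = ≈-refl
  ⨁-tabulate {n = suc n} g f = ∙-congˡ (⨁-tabulate (g ∘ suc) f)

-- Insertion of the greatest letter.

insertMax : Fin (suc n) → Permutation′ n → Permutation′ (suc n)
insertMax {n} i π = insert i (fromℕ n) π

punchIn-fromℕ : ∀ (k : Fin n) → punchIn (fromℕ n) k ≡ inject₁ k
punchIn-fromℕ zero    = refl
punchIn-fromℕ (suc k) = cong suc (punchIn-fromℕ k)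

inject₁<fromℕ : ∀ (k : Fin n) → inject₁ k Fin.< fromℕ n
inject₁<fromℕ {n} k rewrite Fin.toℕ-inject₁ k | Fin.toℕ-fromℕ n = Fin.toℕ<n k

fromℕ≮ : ∀ (k : Fin (suc n)) → ¬ fromℕ n Fin.< k
fromℕ≮ k max<k = ℕ.<⇒≱ max<k (Fin.≤fromℕ k)

inject₁-<⇔ : ∀ {i j : Fin n} → inject₁ i Fin.< inject₁ j ⇔ i Fin.< j
inject₁-<⇔ {i = i} {j} rewrite Fin.toℕ-inject₁ i | Fin.toℕ-inject₁ j = mk⇔ id id

punchIn-<⇔ : ∀ (i : Fin (suc n)) {j k} → punchIn i j Fin.< punchIn i k ⇔ j Fin.< k
punchIn-<⇔ i {j} {k} = mk⇔
  (λ lt → ℕ.≰⇒> λ k≤j → ℕ.<⇒≱ lt (Fin.punchIn-mono-≤ i k j k≤j))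
  (λ lt → ℕ.≰⇒> λ le → ℕ.<⇒≱ lt (Fin.punchIn-cancel-≤ i k j le))

-- Case distinction on positions after an insertion: a position is either the new one or the image
-- of an old one.
punchIn-elim : ∀ {p} (i : Fin (suc n)) (P : Fin (suc n) → Set p) →
               P i → (∀ k → P (punchIn i k)) → ∀ j → P j
punchIn-elim i P Pi Pp j with i Fin.≟ j
... | yes i≡j = subst P i≡j Pi
... | no  i≢j = subst P (Fin.punchIn-punchOut i≢j) (Pp (punchOut i≢j))

insertMax-at : ∀ i (π : Permutation′ n) → insertMax i π ⟨$⟩ʳ i ≡ fromℕ n
insertMax-at i π with i Fin.≟ i
... | yes _   = refl
... | no  i≢i = contradiction refl i≢i

insertMax-punchIn : ∀ i (π : Permutation′ n) k →
                    insertMax i π ⟨$⟩ʳ punchIn i k ≡ inject₁ (π ⟨$⟩ʳ k)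
insertMax-punchIn i π k = trans (insert-punchIn i _ π k) (punchIn-fromℕ _)

insertMax-<⇔ : ∀ i (π : Permutation′ n) k l →
  insertMax i π ⟨$⟩ʳ punchIn i k Fin.< insertMax i π ⟨$⟩ʳ punchIn i l ⇔ π ⟨$⟩ʳ k Fin.< π ⟨$⟩ʳ l
insertMax-<⇔ i π k l rewrite insertMax-punchIn i π k | insertMax-punchIn i π l = inject₁-<⇔

insertMax-max : ∀ i (π : Permutation′ n) k →
  insertMax i π ⟨$⟩ʳ punchIn i k Fin.< insertMax i π ⟨$⟩ʳ i
insertMax-max i π k rewrite insertMax-at i π | insertMax-punchIn i π k = inject₁<fromℕ _

insertMax-≮ : ∀ i (π : Permutation′ n) j → ¬ insertMax i π ⟨$⟩ʳ i Fin.< insertMax i π ⟨$⟩ʳ j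
insertMax-≮ i π j rewrite insertMax-at i π = fromℕ≮ _

-- Right-to-left minima after an insertion.

∈-subset : ∀ {P : Pred (Fin n) 0ℓ} (P? : Decidable P) {i} → i ∈ subset P? ⇔ P i
∈-subset P? {i} = mk⇔ ⇒ ⇐
  where
  lookup-does : lookup (subset P?) i ≡ does (P? i)
  lookup-does = Vec.lookup∘tabulate (does ∘ P?) i

  ⇒ : i ∈ subset P? → _
  ⇒ i∈ with P? i | trans (sym lookup-does) (Vec.[]=⇒lookup i∈)
  ... | yes Pi | _ = Pi

  ⇐ : _ → i ∈ subset P?
  ⇐ Pi = Vec.lookup⇒[]= i _ (trans lookup-does (dec-true (P? i) Pi))

-- In last place the condition is vacuous; anywhere else the last position would have to hold a
-- value above the greatest letter.
isRLMi-at : ∀ i (π : Permutation′ n) → IsRLMi (insertMax i π) i ⇔ i ≡ fromℕ n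
isRLMi-at {n} i π = mk⇔ ⇒ ⇐
  where
  ⇒ : IsRLMi (insertMax i π) i → i ≡ fromℕ n
  ⇒ h with i Fin.≟ fromℕ n
  ... | yes i≡max = i≡max
  ... | no  i≢max = contradiction (h (fromℕ n) (Fin.≤∧≢⇒< (Fin.≤fromℕ i) i≢max)) (insertMax-≮ i π _)

  ⇐ : i ≡ fromℕ n → IsRLMi (insertMax i π) i
  ⇐ i≡max j i<j = contradiction (subst (Fin._< j) i≡max i<j) (fromℕ≮ j)

-- The only new condition compares an old letter with the greatest one and always holds; the order
-- among old positions and among old letters is preserved.
isRLMi-punchIn : ∀ i (π : Permutation′ n) k →
                 IsRLMi (insertMax i π) (punchIn i k) ⇔ IsRLMi π k
isRLMi-punchIn i π k = mk⇔
  (λ h l k<l → to (insertMax-<⇔ i π k l) (h _ (from (punchIn-<⇔ i) k<l)))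
  (λ h → punchIn-elim i _ (λ _ → insertMax-max i π k)
    λ l k<l → from (insertMax-<⇔ i π k l) (h l (to (punchIn-<⇔ i) k<l)))

-- Old positions carry values in the image of `inject₁`, so the greatest letter stands at `i` alone
-- and the question reduces to `isRLMi-at`.
isRLMv-fromℕ : ∀ i (π : Permutation′ n) → IsRLMv (insertMax i π) (fromℕ n) ⇔ i ≡ fromℕ n
isRLMv-fromℕ {n} i π = mk⇔
  (λ { (j , j∈ , eq) → punchIn-elim i
         (λ j → IsRLMi σ j → σ ⟨$⟩ʳ j ≡ fromℕ n → i ≡ fromℕ n)
         (λ h _ → to (isRLMi-at i π) h)
         (λ k _ eq′ → contradiction (trans (sym eq′) (insertMax-punchIn i π k)) Fin.fromℕ≢inject₁)
         j (to (∈-subset (isRLMi? σ)) j∈) eq })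
  (λ i≡max → i , from (∈-subset (isRLMi? σ)) (from (isRLMi-at i π) i≡max) , insertMax-at i π)
  where σ = insertMax i π

isRLMv-inject₁ : ∀ i (π : Permutation′ n) v → IsRLMv (insertMax i π) (inject₁ v) ⇔ IsRLMv π v
isRLMv-inject₁ i π v = mk⇔
  (λ { (j , j∈ , eq) → punchIn-elim i
         (λ j → IsRLMi σ j → σ ⟨$⟩ʳ j ≡ inject₁ v → IsRLMv π v)
         (λ _ eq′ → contradiction (trans (sym (insertMax-at i π)) eq′) Fin.fromℕ≢inject₁)
         (λ k h eq′ → k , from (∈-subset (isRLMi? π)) (to (isRLMi-punchIn i π k) h)
                        , Fin.inject₁-injective (trans (sym (insertMax-punchIn i π k)) eq′))
         j (to (∈-subset (isRLMi? σ)) j∈) eq })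
  (λ { (k , k∈ , eq) →
         punchIn i k
       , from (∈-subset (isRLMi? σ)) (from (isRLMi-punchIn i π k) (to (∈-subset (isRLMi? π)) k∈))
       , trans (insertMax-punchIn i π k) (cong inject₁ eq) })
  where σ = insertMax i π

tabulate-∷ʳ : ∀ {A : Set} (f : Fin (suc n) → A) →
              Vec.tabulate f ≡ Vec.tabulate (f ∘ inject₁) ∷ʳ f (fromℕ n)
tabulate-∷ʳ {zero}  f = refl
tabulate-∷ʳ {suc n} f = cong (f zero Vec.∷_) (tabulate-∷ʳ (f ∘ suc))

-- The new letter is the last index of the subset, so the old membership bits keep their places and
-- the insertion appends a single bit.
RLMv-insertMax : ∀ i (π : Permutation′ n) →
                 RLMv (insertMax i π) ≡ RLMv π ∷ʳ does (i Fin.≟ fromℕ n)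
RLMv-insertMax i π = trans (tabulate-∷ʳ (does ∘ isRLMv? (insertMax i π))) (cong₂ _∷ʳ_
  (Vec.tabulate-cong λ v → does-⇔ (isRLMv-inject₁ i π v) (isRLMv? (insertMax i π) (inject₁ v)) (isRLMv? π v))
  (does-⇔ (isRLMv-fromℕ i π) (isRLMv? (insertMax i π) (fromℕ _)) (i Fin.≟ fromℕ _)))

-- Inversions after an insertion.

indicator : {P : Set} → Dec P → ℕ
indicator P? = if does P? then 1 else 0

open Sum ℕ.+-0-commutativeMonoid using (sum-cong-≗; sum-remove) renaming (sum to sumℕ)
module ℕΣ = ListSum ℕ.+-0-commutativeMonoid

length-filter : ∀ {A : Set} {P : Pred A 0ℓ} (P? : Decidable P) xs →
                length (filter P? xs) ≡ ℕΣ.⨁ xs (indicator ∘ P?)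
length-filter P? []       = refl
length-filter P? (x ∷ xs) with does (P? x)
... | true  = cong suc (length-filter P? xs)
... | false = length-filter P? xs

-- As a double sum over positions, the count lets `sum-remove` split off the row and the column of
-- the inserted position.
inv-sum : ∀ (π : Permutation′ n) → inv π ≡ sumℕ λ i → sumℕ λ j → indicator (inversion? π (i , j))
inv-sum {n} π = begin
  inv π
    ≡⟨ length-filter (inversion? π) (cartesianProduct (allFin n) (allFin n)) ⟩
  ℕΣ.⨁ (cartesianProduct (allFin n) (allFin n)) χ
    ≡⟨ ℕΣ.⨁-cartesianProductWith _,_ (allFin n) (allFin n) χ ⟩
  ℕΣ.⨁ (allFin n) (λ i → ℕΣ.⨁ (allFin n) (λ j → χ (i , j)))
    ≡⟨ ℕΣ.⨁-tabulate {n = n} id (λ i → ℕΣ.⨁ (allFin n) (λ j → χ (i , j))) ⟩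
  sumℕ (λ i → ℕΣ.⨁ (allFin n) (λ j → χ (i , j)))
    ≡⟨ sum-cong-≗ (λ i → ℕΣ.⨁-tabulate {n = n} id (λ j → χ (i , j))) ⟩
  sumℕ (λ i → sumℕ (λ j → χ (i , j)))
    ∎
  where
  open ≡-Reasoning
  χ = λ ij → indicator (inversion? π ij)

sum-<-punchIn : ∀ (i : Fin (suc n)) → sumℕ (λ k → indicator (i Fin.<? punchIn i k)) ≡ n ℕ.∸ toℕ i
sum-<-punchIn {zero}  zero    = refl
sum-<-punchIn {suc n} zero    = cong suc (sum-<-punchIn {n} zero)
sum-<-punchIn {suc n} (suc i) = sum-<-punchIn i

-- In row `i` the greatest letter is inverted with every later position; in column `i` nothing
-- exceeds it, so there is no inversion. The remaining entries are those of `π`.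
inv-insertMax : ∀ i (π : Permutation′ n) → inv (insertMax i π) ≡ (n ℕ.∸ toℕ i) ℕ.+ inv π
inv-insertMax {n} i π = begin
  inv σ
    ≡⟨ inv-sum σ ⟩
  sumℕ (λ a → sumℕ (χ σ a))
    ≡⟨ sum-remove (λ a → sumℕ (χ σ a)) ⟩
  sumℕ (χ σ i) ℕ.+ sumℕ (λ k → sumℕ (χ σ (punchIn i k)))
    ≡⟨ cong₂ ℕ._+_ row rest ⟩
  (n ℕ.∸ toℕ i) ℕ.+ sumℕ (λ k → sumℕ (χ π k))
    ≡⟨ cong ((n ℕ.∸ toℕ i) ℕ.+_) (inv-sum π) ⟨
  (n ℕ.∸ toℕ i) ℕ.+ inv π
    ∎
  where
  open ≡-Reasoning
  σ = insertMax i π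

  χ : ∀ {n} → Permutation′ n → Fin n → Fin n → ℕ
  χ ρ a b = indicator (inversion? ρ (a , b))

  χ-zero : ∀ a b → ¬ Inversion σ (a , b) → χ σ a b ≡ 0
  χ-zero a b ¬inv = cong (if_then 1 else 0) (dec-false (inversion? σ (a , b)) ¬inv)

  row : sumℕ (χ σ i) ≡ n ℕ.∸ toℕ i
  row = begin
    sumℕ (χ σ i)
      ≡⟨ sum-remove {i = i} (χ σ i) ⟩
    χ σ i i ℕ.+ sumℕ (λ k → χ σ i (punchIn i k))
      ≡⟨ cong₂ ℕ._+_ (χ-zero i i λ { (i<i , _) → ℕ.<-irrefl refl i<i })
           (sum-cong-≗ λ k → cong (if_then 1 else 0) (does-⇔ (mk⇔ proj₁ (_, insertMax-max i π k))
             (inversion? σ (i , punchIn i k)) (i Fin.<? punchIn i k))) ⟩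
    sumℕ (λ k → indicator (i Fin.<? punchIn i k))
      ≡⟨ sum-<-punchIn i ⟩
    n ℕ.∸ toℕ i
      ∎

  rest : sumℕ (λ k → sumℕ (χ σ (punchIn i k))) ≡ sumℕ (λ k → sumℕ (χ π k))
  rest = sum-cong-≗ λ k → begin
    sumℕ (χ σ (punchIn i k))
      ≡⟨ sum-remove {i = i} (χ σ (punchIn i k)) ⟩
    χ σ (punchIn i k) i ℕ.+ sumℕ (λ l → χ σ (punchIn i k) (punchIn i l))
      ≡⟨ cong₂ ℕ._+_ (χ-zero (punchIn i k) i (insertMax-≮ i π _ ∘ proj₂))
           (sum-cong-≗ λ l → cong (if_then 1 else 0) (does-⇔ (inversion-⇔ k l)
             (inversion? σ (punchIn i k , punchIn i l)) (inversion? π (k , l)))) ⟩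
    sumℕ (χ π k) ∎
    where
    inversion-⇔ : ∀ k l → Inversion σ (punchIn i k , punchIn i l) ⇔ Inversion π (k , l)
    inversion-⇔ k l = mk⇔
      (λ { (k<l , gt) → to (punchIn-<⇔ i) k<l , to (insertMax-<⇔ i π l k) gt })
      (λ { (k<l , gt) → from (punchIn-<⇔ i) k<l , from (insertMax-<⇔ i π l k) gt })

-- Parity, and membership in a subset extended by one bit.

even⊎even-suc : ∀ n → Even n ⊎ Even (suc n)
even⊎even-suc zero    = inj₁ (2 ℕ.∣0)
even⊎even-suc (suc n) with even⊎even-suc n
... | inj₁ even = inj₂ (ℕ.∣m∣n⇒∣m+n ℕ.∣-refl even)
... | inj₂ even = inj₁ even

¬even-consecutive : ∀ n → Even n → ¬ Even (suc n)
¬even-consecutive n even even-suc =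
  contradiction (ℕ.∣1⇒≡1 (ℕ.∣m+n∣m⇒∣n (subst Even (ℕ.+-comm 1 n) even-suc) even)) λ ()

-- Divisibility by 2 does not unfold along `suc`. Rewriting with this equation supplies the
-- recursion for the parity computations below.
even?-suc : ∀ n → does (even? (suc n)) ≡ not (does (even? n))
even?-suc n with even⊎even-suc n
... | inj₁ even = trans (dec-false (even? (suc n)) (¬even-consecutive n even))
                        (cong not (sym (dec-true (even? n) even)))
... | inj₂ even = trans (dec-true (even? (suc n)) even)
                        (cong not (sym (dec-false (even? n) λ even′ → ¬even-consecutive n even′ even)))

lookup-∷ʳ-inject₁ : ∀ (S : Subset n) b i → lookup (S ∷ʳ b) (inject₁ i) ≡ lookup S i
lookup-∷ʳ-inject₁ (a Vec.∷ S) b zero    = refl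
lookup-∷ʳ-inject₁ (a Vec.∷ S) b (suc i) = lookup-∷ʳ-inject₁ S b i

lookup-∷ʳ-fromℕ : ∀ (S : Subset n) b → lookup (S ∷ʳ b) (fromℕ n) ≡ b
lookup-∷ʳ-fromℕ Vec.[]      b = refl
lookup-∷ʳ-fromℕ (a Vec.∷ S) b = lookup-∷ʳ-fromℕ S b

-- Signed sums over permutations in a commutative ring.

module SignedSum {c ℓ} (R : CommutativeRing c ℓ) where

  open CommutativeRing R renaming (refl to ≈-refl; sym to ≈-sym; trans to ≈-trans)
  open RingProperties ring using (-1*x≈-x; -‿involutive)
  open Exp semiring using (_^_; ^-homo-*)
  open Sum +-commutativeMonoid using (sum; sum-cong-≋)
  module +Σ = ListSum +-commutativeMonoid
  open +Σ using (⨁; ⨁-cong)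
  open CommutativeSemigroupProperties *-commutativeSemigroup using (x∙yz≈y∙xz)
  open SemiringSum semiring using (*-distribˡ-sum)
  open SetoidReasoning setoid

  sign : ℕ → Carrier
  sign m = (- 1#) ^ m

  -- Ring and weight are arbitrary so that one recursion serves twice: with monomials in
  -- ℤ[x₁, ..., xₙ] for the first identity, and with indicators of a cardinality in ℤ for the
  -- second.
  signedSum : ∀ n → (Subset n → Carrier) → Carrier
  signedSum n w = ⨁ (𝔖 n) λ π → sign (inv π) * w (RLMv π)

  -- The value of ∑ (-1)ⁿ⁻ⁱ over 0 ≤ i < n.
  alternating : ℕ → Carrier
  alternating n = if does (even? (suc n)) then - 1# else 0#

  sign-parity : ∀ n → sign n ≈ (if does (even? n) then 1# else - 1#)
  sign-parity zero    = ≈-refl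
  sign-parity (suc n) rewrite even?-suc n = ≈-trans (*-congˡ (sign-parity n)) (flip (does (even? n)))
    where
    flip : ∀ b → - 1# * (if b then 1# else - 1#) ≈ (if not b then 1# else - 1#)
    flip true  = *-identityʳ (- 1#)
    flip false = ≈-trans (-1*x≈-x (- 1#)) (-‿involutive 1#)

  -- In ∑ (-1)ⁿ⁺¹⁻ⁱ over 0 ≤ i ≤ n, the term i = 0 is `sign (suc n)`, and shifting i turns the other
  -- terms into the sum for `n`.
  sign-alternating : ∀ n → sign (suc n) + alternating n ≈ alternating (suc n)
  sign-alternating n rewrite even?-suc (suc n) =
    ≈-trans (+-congʳ (sign-parity (suc n))) (cancel (does (even? (suc n))))
    where
    cancel : ∀ b → (if b then 1# else - 1#) + (if b then - 1# else 0#) ≈ (if not b then - 1# else 0#)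
    cancel true  = -‿inverseʳ 1#
    cancel false = +-identityʳ (- 1#)

  -- The last position has sign 1 and bit `true`. All earlier ones share the factor `u false`, and
  -- their signs add up to `alternating n`.
  sum-sign-last : ∀ n (u : Bool → Carrier) →
    sum {suc n} (λ i → sign (n ℕ.∸ toℕ i) * u (does (i Fin.≟ fromℕ n))) ≈ u true + alternating n * u false
  sum-sign-last zero    u = +-cong (*-identityˡ (u true)) (≈-sym (zeroˡ (u false)))
  sum-sign-last (suc n) u = begin
    sign (suc n) * u false + sum {suc n} (λ i → sign (n ℕ.∸ toℕ i) * u (does (i Fin.≟ fromℕ n)))
      -- With position 0 split off, both `∸` and `≟` cancel one `suc`, so the remaining sum is the
      -- one for `n`.
      ≈⟨ +-congˡ (sum-sign-last n u) ⟩
    sign (suc n) * u false + (u true + alternating n * u false)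
      ≈⟨ x+yz≈y+xz _ _ _ ⟩
    u true + (sign (suc n) * u false + alternating n * u false)
      ≈⟨ +-congˡ (≈-sym (distribʳ (u false) _ _)) ⟩
    u true + (sign (suc n) + alternating n) * u false
      ≈⟨ +-congˡ (*-congʳ (sign-alternating n)) ⟩
    u true + alternating (suc n) * u false
      ∎
    where
    open CommutativeSemigroupProperties (CommutativeMonoid.commutativeSemigroup +-commutativeMonoid)
      renaming (x∙yz≈y∙xz to x+yz≈y+xz)

  -- Once the sums are exchanged, `π` is fixed while the position varies. The sign factors by
  -- `inv-insertMax`, and the weight takes only two values, so `sum-sign-last` evaluates the inner
  -- sum.
  signedSum-suc : ∀ n w → signedSum (suc n) w ≈
    signedSum n (λ S → w (S ∷ʳ true) + alternating n * w (S ∷ʳ false))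
  signedSum-suc n w = begin
    signedSum (suc n) w
      ≈⟨ +Σ.⨁-cartesianProductWith insertMax (allFin (suc n)) (𝔖 n) _ ⟩
    ⨁ (allFin (suc n)) (λ i → ⨁ (𝔖 n) (λ π → term (insertMax i π)))
      ≈⟨ +Σ.⨁-swap (allFin (suc n)) (𝔖 n) _ ⟩
    ⨁ (𝔖 n) (λ π → ⨁ (allFin (suc n)) (λ i → term (insertMax i π)))
      ≈⟨ ⨁-cong (𝔖 n) inner ⟩
    signedSum n (λ S → w (S ∷ʳ true) + alternating n * w (S ∷ʳ false))
      ∎
    where
    term : Permutation′ (suc n) → Carrier
    term σ = sign (inv σ) * w (RLMv σ)

    term-insertMax : ∀ i (π : Permutation′ n) → term (insertMax i π) ≈
      sign (inv π) * (sign (n ℕ.∸ toℕ i) * w (RLMv π ∷ʳ does (i Fin.≟ fromℕ n)))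
    term-insertMax i π rewrite inv-insertMax i π | RLMv-insertMax i π =
      ≈-trans (*-congʳ (^-homo-* (- 1#) (n ℕ.∸ toℕ i) (inv π)))
        (≈-trans (*-congʳ (*-comm _ _)) (*-assoc _ _ _))

    inner : ∀ π → ⨁ (allFin (suc n)) (λ i → term (insertMax i π)) ≈
                  sign (inv π) * (w (RLMv π ∷ʳ true) + alternating n * w (RLMv π ∷ʳ false))
    inner π = begin
      ⨁ (allFin (suc n)) (λ i → term (insertMax i π))
        ≈⟨ +Σ.⨁-tabulate {n = suc n} id (λ i → term (insertMax i π)) ⟩
      sum (λ i → term (insertMax i π))
        ≈⟨ sum-cong-≋ (λ i → term-insertMax i π) ⟩
      sum (λ i → sign (inv π) * (sign (n ℕ.∸ toℕ i) * w (RLMv π ∷ʳ does (i Fin.≟ fromℕ n))))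
        ≈⟨ *-distribˡ-sum {suc n} (sign (inv π)) (λ i → sign (n ℕ.∸ toℕ i) * w (RLMv π ∷ʳ does (i Fin.≟ fromℕ n))) ⟨
      sign (inv π) * sum (λ i → sign (n ℕ.∸ toℕ i) * w (RLMv π ∷ʳ does (i Fin.≟ fromℕ n)))
        ≈⟨ *-congˡ (sum-sign-last n (λ b → w (RLMv π ∷ʳ b))) ⟩
      sign (inv π) * (w (RLMv π ∷ʳ true) + alternating n * w (RLMv π ∷ʳ false))
        ∎

  signedSum-cong : ∀ n {w w′} → (∀ S → w S ≈ w′ S) → signedSum n w ≈ signedSum n w′
  signedSum-cong n w≈w′ = ⨁-cong (𝔖 n) λ π → *-congˡ (w≈w′ (RLMv π))

  signedSum-*ˡ : ∀ n a w → signedSum n (λ S → a * w S) ≈ a * signedSum n w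
  signedSum-*ˡ n a w = go (𝔖 n)
    where
    go : ∀ πs → ⨁ πs (λ π → sign (inv π) * (a * w (RLMv π))) ≈ a * ⨁ πs (λ π → sign (inv π) * w (RLMv π))
    go []       = ≈-sym (zeroʳ a)
    go (π ∷ πs) = ≈-trans (+-cong (x∙yz≈y∙xz _ a _) (go πs)) (≈-sym (distribˡ a _ _))

  -- Multiplicative weights and the product formula.

  open Sum *-commutativeMonoid using ()
    renaming ( sum to product; sum-cong-≋ to product-cong
             ; sum-init-last to product-init-last; ∑-distrib-+ to product-distrib )

  -- The monomial of `S`. Indices outside `S` contribute 1, so the product runs over all of `Fin n`
  -- and its last factor can be split off.
  weight : (Fin n → Carrier) → Subset n → Carrier
  weight x S = product λ i → if lookup S i then x i else 1#

  weight-∷ʳ : ∀ (x : Fin (suc n) → Carrier) S b →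
              weight x (S ∷ʳ b) ≈ weight (x ∘ inject₁) S * (if b then x (fromℕ n) else 1#)
  weight-∷ʳ {n} x S b = ≈-trans (product-init-last λ i → if lookup (S ∷ʳ b) i then x i else 1#)
    (*-cong (product-cong λ i → reflexive (cong (if_then x (inject₁ i) else 1#) (lookup-∷ʳ-inject₁ S b i)))
            (reflexive (cong (if_then x (fromℕ n) else 1#) (lookup-∷ʳ-fromℕ S b))))

  -- Appending a bit multiplies the weight by `x (fromℕ n)` or by 1. The resulting factor
  -- `x (fromℕ n) + alternating n` is the same for every `S` and leaves the sum.
  signedSum-weight : ∀ n (x : Fin n → Carrier) →
                     signedSum n (weight x) ≈ product λ i → x i + alternating (toℕ i)
  signedSum-weight zero    x = ≈-trans (+-identityʳ _) (*-identityˡ 1#)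
  signedSum-weight (suc n) x = begin
    signedSum (suc n) (weight x)
      ≈⟨ signedSum-suc n (weight x) ⟩
    signedSum n (λ S → weight x (S ∷ʳ true) + alternating n * weight x (S ∷ʳ false))
      ≈⟨ signedSum-cong n factor ⟩
    signedSum n (λ S → (x (fromℕ n) + alternating n) * weight x′ S)
      ≈⟨ signedSum-*ˡ n (x (fromℕ n) + alternating n) (weight x′) ⟩
    (x (fromℕ n) + alternating n) * signedSum n (weight x′)
      ≈⟨ *-comm _ _ ⟩
    signedSum n (weight x′) * (x (fromℕ n) + alternating n)
      -- `alternating` sees an index only through `toℕ`, which `inject₁` preserves.
      ≈⟨ *-cong (≈-trans (signedSum-weight n x′) (product-cong λ i →
                   reflexive (cong (λ m → x′ i + alternating m) (sym (Fin.toℕ-inject₁ i)))))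
                (reflexive (cong (λ m → x (fromℕ n) + alternating m) (sym (Fin.toℕ-fromℕ n)))) ⟩
    product (λ i → x′ i + alternating (toℕ (inject₁ i))) * (x (fromℕ n) + alternating (toℕ (fromℕ n)))
      ≈⟨ product-init-last (λ i → x i + alternating (toℕ i)) ⟨
    product (λ i → x i + alternating (toℕ i))
      ∎
    where
    x′ = x ∘ inject₁

    factor : ∀ S → weight x (S ∷ʳ true) + alternating n * weight x (S ∷ʳ false) ≈
                   (x (fromℕ n) + alternating n) * weight x′ S
    factor S = begin
      weight x (S ∷ʳ true) + alternating n * weight x (S ∷ʳ false)
        ≈⟨ +-cong (≈-trans (weight-∷ʳ x S true) (*-comm _ _))
                  (*-congˡ (≈-trans (weight-∷ʳ x S false) (*-identityʳ _))) ⟩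
      x (fromℕ n) * weight x′ S + alternating n * weight x′ S
        ≈⟨ distribʳ _ _ _ ⟨
      (x (fromℕ n) + alternating n) * weight x′ S
        ∎

  signedSum-+ : ∀ n w w′ → signedSum n (λ S → w S + w′ S) ≈ signedSum n w + signedSum n w′
  signedSum-+ n w w′ = ≈-trans (⨁-cong (𝔖 n) λ π → distribˡ (sign (inv π)) _ _)
    (+Σ.⨁-∙ (𝔖 n) (λ π → sign (inv π) * w (RLMv π)) (λ π → sign (inv π) * w′ (RLMv π)))

  module *Σ = ListSum *-commutativeMonoid

  ⨁-∈?-weight : ∀ (S : Subset n) x → *Σ.⨁ (filter (_∈? S) (allFin n)) x ≈ weight x S
  ⨁-∈?-weight {n} S x = begin
    *Σ.⨁ (filter (_∈? S) (allFin n)) x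
      ≈⟨ *Σ.⨁-filter (_∈? S) (allFin n) x ⟩
    *Σ.⨁ (allFin n) (λ i → if does (i ∈? S) then x i else 1#)
      ≈⟨ *Σ.⨁-tabulate {n = n} id (λ i → if does (i ∈? S) then x i else 1#) ⟩
    product (λ i → if does (i ∈? S) then x i else 1#)
      ≈⟨ product-cong (λ i → reflexive (cong (if_then x i else 1#) (does-∈? i S))) ⟩
    weight x S
      ∎
    where
    does-∈? : ∀ {n} (i : Fin n) S → does (i ∈? S) ≡ lookup S i
    does-∈? zero    (true  Vec.∷ S) = refl
    does-∈? zero    (false Vec.∷ S) = refl
    does-∈? (suc i) (b     Vec.∷ S) = does-∈? i S

  -- Each index lies in exactly one of the two sets and contributes 1 to the other product. Index i
  -- stands for the letter i + 1, so `alternating (toℕ i)` is -1 exactly on `evens n`.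
  weight-odds-evens : ∀ n (x : Fin n → Carrier) →
    weight x (odds n) * weight (λ j → x j - 1#) (evens n) ≈ product λ i → x i + alternating (toℕ i)
  weight-odds-evens n x = ≈-trans
    (≈-sym (product-distrib (λ i → if lookup (odds n) i then x i else 1#)
                            (λ j → if lookup (evens n) j then x j - 1# else 1#)))
    (product-cong factor)
    where
    merge : ∀ b a → (if not b then a else 1#) * (if b then a - 1# else 1#) ≈ a + (if b then - 1# else 0#)
    merge true  a = *-identityˡ (a - 1#)
    merge false a = ≈-trans (*-identityʳ a) (≈-sym (+-identityʳ a))

    factor : ∀ i → (if lookup (odds n) i then x i else 1#) * (if lookup (evens n) i then x i - 1# else 1#)
                   ≈ x i + alternating (toℕ i)
    factor i rewrite Vec.lookup∘tabulate (λ i → does (odd? (suc (toℕ i)))) i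
                   | Vec.lookup∘tabulate (λ i → does (even? (suc (toℕ i)))) i
      = merge (does (even? (suc (toℕ i)))) (x i)

-- The polynomial identity.

∑-sign-RLMv : ∀ n → (∑[ π ← 𝔖 n ] ((-ₚ 1ₚ) ^ₚ inv π *ₚ 𝐱 (RLMv π)))
                    ≈ₚ (∏[ i ∈ odds n ] var i) *ₚ (∏[ j ∈ evens n ] (var j -ₚ 1ₚ))
∑-sign-RLMv n = begin
  (∑[ π ← 𝔖 n ] ((-ₚ 1ₚ) ^ₚ inv π *ₚ 𝐱 (RLMv π)))
    -- The left side unfolds to `signedSum n 𝐱`, so only the weight has to be replaced.
    ≈⟨ signedSum-cong n (λ S → ⨁-∈?-weight S var) ⟩
  signedSum n (weight var)
    ≈⟨ signedSum-weight n var ⟩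
  _
    ≈⟨ weight-odds-evens n var ⟨
  weight var (odds n) *ₚ weight (λ j → var j -ₚ 1ₚ) (evens n)
    ≈⟨ *-cong (⨁-∈?-weight (odds n) var) (⨁-∈?-weight (evens n) (λ j → var j -ₚ 1ₚ)) ⟨
  (∏[ i ∈ odds n ] var i) *ₚ (∏[ j ∈ evens n ] (var j -ₚ 1ₚ))
    ∎
  where
  open SignedSum (ℤ[𝐱] n)
  open CommutativeRing (ℤ[𝐱] n) using (*-cong; setoid)
  open SetoidReasoning setoid

-- Pascal's rule for the shifted binomial coefficients.

open SignedSum ℤ.+-*-commutativeRing

-- As `⌈ n /2⌉` is `⌊ suc n /2⌋` by definition, this expresses all halves of `n` and `suc n` through
-- `⌊ n /2⌋` and the parity of `n`.
⌈n/2⌉-parity : ∀ n → ⌈ n /2⌉ ≡ (if does (even? n) then ⌊ n /2⌋ else suc ⌊ n /2⌋)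
⌈n/2⌉-parity zero    = refl
⌈n/2⌉-parity (suc n) rewrite even?-suc n | ⌈n/2⌉-parity n with does (even? n)
... | true  = refl
... | false = refl

nC0≡1 : ∀ n → n C 0 ≡ 1
nC0≡1 n = trans (nCk≡nC[n∸k] {0} {n} z≤n) (nCn≡1 n)

-- Lowering `k` and `c` together keeps the differences. This ends at index 0, where the term of
-- index -1 vanishes, at a negative index, where all terms vanish, or at a positive index, where the
-- usual rule applies.
binomial-pascal : ∀ a k c → binomial (suc a) (k ⊖ c) ≡ binomial a (k ⊖ suc c) ℕ.+ binomial a (k ⊖ c)
binomial-pascal a zero    zero    = trans (nC0≡1 (suc a)) (sym (nC0≡1 a))
binomial-pascal a zero    (suc c) = refl
binomial-pascal a (suc k) zero    = sym (nCk+nC[k+1]≡[n+1]C[k+1] a k)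
binomial-pascal a (suc k) (suc c)
  rewrite ℤ.[1+m]⊖[1+n]≡m⊖n k c | ℤ.[1+m]⊖[1+n]≡m⊖n k (suc c) = binomial-pascal a k c

shiftedBinomial : ℕ → ℕ → ℤ
shiftedBinomial n k = + binomial ⌊ n /2⌋ (k ⊖ ⌈ n /2⌉)

-- For even `n` the coefficient `alternating n` is 0 and only the ceiling grows, along with `k`. For
-- odd `n` it is -1, only the floor grows, and Pascal's rule applies. The minus sign absorbs the
-- opposite signs that belong to `k` and `suc k`.
shiftedBinomial-suc : ∀ n k →
  shiftedBinomial (suc n) (suc k) ≡ shiftedBinomial n k -ℤ alternating n *ℤ shiftedBinomial n (suc k)
shiftedBinomial-suc n k rewrite even?-suc n | ⌈n/2⌉-parity n with does (even? n)
... | true  rewrite ℤ.[1+m]⊖[1+n]≡m⊖n k ⌊ n /2⌋ = sym (ℤ.+-identityʳ _)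
... | false rewrite ℤ.[1+m]⊖[1+n]≡m⊖n k ⌊ n /2⌋ | binomial-pascal ⌊ n /2⌋ k ⌊ n /2⌋
  = rearrange (+ binomial ⌊ n /2⌋ (k ⊖ suc ⌊ n /2⌋)) (+ binomial ⌊ n /2⌋ (k ⊖ ⌊ n /2⌋))
  where
  rearrange : ∀ a b → a ℤ.+ b ≡ a -ℤ -1ℤ *ℤ b
  rearrange = solve-∀

-- For even `n` the first factor is 0; for odd `n` the ceiling is positive, so the lower index is
-- negative.
alternating-shiftedBinomial-zero : ∀ n → alternating n *ℤ shiftedBinomial n 0 ≡ 0ℤ
alternating-shiftedBinomial-zero n rewrite even?-suc n | ⌈n/2⌉-parity n with does (even? n)
... | true  = refl
... | false = refl

-- Signed counts by the number of right-to-left minima.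

δ : ℕ → Subset n → ℤ
δ k S = if does (∣ S ∣ ≟ k) then 1ℤ else 0ℤ

∣∷ʳ∣ : ∀ (S : Subset n) b → ∣ S ∷ʳ b ∣ ≡ (if b then suc ∣ S ∣ else ∣ S ∣)
∣∷ʳ∣ Vec.[]            true  = refl
∣∷ʳ∣ Vec.[]            false = refl
∣∷ʳ∣ (true  Vec.∷ S)   true  = cong suc (∣∷ʳ∣ S true)
∣∷ʳ∣ (true  Vec.∷ S)   false = cong suc (∣∷ʳ∣ S false)
∣∷ʳ∣ (false Vec.∷ S)   b     = ∣∷ʳ∣ S b

δ-∷ʳ : ∀ k (S : Subset n) b →
       δ k (S ∷ʳ b) ≡ (if does ((if b then suc ∣ S ∣ else ∣ S ∣) ≟ k) then 1ℤ else 0ℤ)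
δ-∷ʳ k S b = cong (λ m → if does (m ≟ k) then 1ℤ else 0ℤ) (∣∷ʳ∣ S b)

-- A bit `true` raises the cardinality by one, so the old set must have `k` elements; a bit `false`
-- leaves the cardinality unchanged.
signedSum-δ-suc : ∀ n k → signedSum (suc n) (δ (suc k)) ≡
                  signedSum n (δ k) ℤ.+ alternating n *ℤ signedSum n (δ (suc k))
signedSum-δ-suc n k = begin
  signedSum (suc n) (δ (suc k))
    ≡⟨ signedSum-suc n (δ (suc k)) ⟩
  signedSum n (λ S → δ (suc k) (S ∷ʳ true) ℤ.+ alternating n *ℤ δ (suc k) (S ∷ʳ false))
    ≡⟨ signedSum-cong n (λ S → cong₂ (λ y z → y ℤ.+ alternating n *ℤ z)
         (δ-∷ʳ (suc k) S true) (δ-∷ʳ (suc k) S false)) ⟩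
  signedSum n (λ S → δ k S ℤ.+ alternating n *ℤ δ (suc k) S)
    ≡⟨ signedSum-+ n (δ k) (λ S → alternating n *ℤ δ (suc k) S) ⟩
  signedSum n (δ k) ℤ.+ signedSum n (λ S → alternating n *ℤ δ (suc k) S)
    ≡⟨ cong (λ z → signedSum n (δ k) ℤ.+ z) (signedSum-*ˡ n (alternating n) (δ (suc k))) ⟩
  signedSum n (δ k) ℤ.+ alternating n *ℤ signedSum n (δ (suc k))
    ∎
  where open ≡-Reasoning

-- A set containing the new letter is not empty, so only the bit `false` contributes.
signedSum-δ-zero : ∀ n → signedSum (suc n) (δ 0) ≡ alternating n *ℤ signedSum n (δ 0)
signedSum-δ-zero n = begin
  signedSum (suc n) (δ 0)
    ≡⟨ signedSum-suc n (δ 0) ⟩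
  signedSum n (λ S → δ 0 (S ∷ʳ true) ℤ.+ alternating n *ℤ δ 0 (S ∷ʳ false))
    ≡⟨ signedSum-cong n {w′ = λ S → alternating n *ℤ δ 0 S} (λ S → trans
         (cong₂ (λ y z → y ℤ.+ alternating n *ℤ z) (δ-∷ʳ 0 S true) (δ-∷ʳ 0 S false)) (ℤ.+-identityˡ _)) ⟩
  signedSum n (λ S → alternating n *ℤ δ 0 S)
    ≡⟨ signedSum-*ˡ n (alternating n) (δ 0) ⟩
  alternating n *ℤ signedSum n (δ 0)
    ∎
  where open ≡-Reasoning

-- For k ≤ n the sign (-1)ⁿ⁺ᵏ is (-1)ⁿ⁻ᵏ; unlike n ∸ k, n + k obeys the recurrence for all k.
signedSum-δ : ∀ n k → signedSum n (δ k) ≡ sign (n ℕ.+ k) *ℤ shiftedBinomial n k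
signedSum-δ zero    zero    = refl
signedSum-δ zero    (suc k) = sym (ℤ.*-zeroʳ (sign (suc k)))
signedSum-δ (suc n) zero    = begin
  signedSum (suc n) (δ 0)                                  ≡⟨ signedSum-δ-zero n ⟩
  alternating n *ℤ signedSum n (δ 0)                       ≡⟨ cong (alternating n *ℤ_) (signedSum-δ n 0) ⟩
  alternating n *ℤ (sign (n ℕ.+ 0) *ℤ shiftedBinomial n 0) ≡⟨ rearrange (alternating n) (sign (n ℕ.+ 0)) (shiftedBinomial n 0) ⟩
  sign (n ℕ.+ 0) *ℤ (alternating n *ℤ shiftedBinomial n 0) ≡⟨ cong (sign (n ℕ.+ 0) *ℤ_) (alternating-shiftedBinomial-zero n) ⟩
  sign (n ℕ.+ 0) *ℤ 0ℤ                                     ≡⟨ ℤ.*-zeroʳ (sign (n ℕ.+ 0)) ⟩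
  -- The final zero is `shiftedBinomial (suc n) 0`: the ceiling of half of `suc n` is positive,
  -- which makes the lower index negative.
  0ℤ                                                       ≡⟨ ℤ.*-zeroʳ (sign (suc n ℕ.+ 0)) ⟨
  sign (suc n ℕ.+ 0) *ℤ 0ℤ                                 ∎
  where
  open ≡-Reasoning
  rearrange : ∀ a b c → a *ℤ (b *ℤ c) ≡ b *ℤ (a *ℤ c)
  rearrange = solve-∀
signedSum-δ (suc n) (suc k) = begin
  signedSum (suc n) (δ (suc k))
    ≡⟨ signedSum-δ-suc n k ⟩
  signedSum n (δ k) ℤ.+ a *ℤ signedSum n (δ (suc k))
    ≡⟨ cong₂ (λ y z → y ℤ.+ a *ℤ z) (signedSum-δ n k) (signedSum-δ n (suc k)) ⟩
  s *ℤ shiftedBinomial n k ℤ.+ a *ℤ (sign (n ℕ.+ suc k) *ℤ shiftedBinomial n (suc k))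
    ≡⟨ cong (λ m → s *ℤ shiftedBinomial n k ℤ.+ a *ℤ (sign m *ℤ shiftedBinomial n (suc k))) (ℕ.+-suc n k) ⟩
  s *ℤ shiftedBinomial n k ℤ.+ a *ℤ (-1ℤ *ℤ s *ℤ shiftedBinomial n (suc k))
    -- The sum n + k grows by two, which gives the two outer factors -1; the single -1 of the second
    -- term becomes the minus sign of `shiftedBinomial-suc`.
    ≡⟨ rearrange s a (shiftedBinomial n k) (shiftedBinomial n (suc k)) ⟩
  -1ℤ *ℤ (-1ℤ *ℤ s) *ℤ (shiftedBinomial n k -ℤ a *ℤ shiftedBinomial n (suc k))
    ≡⟨ cong₂ (λ m z → -1ℤ *ℤ sign m *ℤ z) (ℕ.+-suc n k) (shiftedBinomial-suc n k) ⟨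
  sign (suc n ℕ.+ suc k) *ℤ shiftedBinomial (suc n) (suc k)
    ∎
  where
  open ≡-Reasoning
  s = sign (n ℕ.+ k)
  a = alternating n
  rearrange : ∀ s a b c → s *ℤ b ℤ.+ a *ℤ (-1ℤ *ℤ s *ℤ c) ≡ -1ℤ *ℤ (-1ℤ *ℤ s) *ℤ (b -ℤ a *ℤ c)
  rearrange = solve-∀

-- From signed sums to counts of even and odd permutations.

sign-+-double : ∀ m k → sign (m ℕ.+ (k ℕ.+ k)) ≡ sign m
sign-+-double m zero    = cong sign (ℕ.+-identityʳ m)
sign-+-double m (suc k) = begin
  sign (m ℕ.+ suc (k ℕ.+ suc k))     ≡⟨ cong sign (trans (ℕ.+-suc m _)
                                          (cong suc (trans (cong (m ℕ.+_) (ℕ.+-suc k k)) (ℕ.+-suc m _)))) ⟩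
  -1ℤ *ℤ (-1ℤ *ℤ sign (m ℕ.+ (k ℕ.+ k))) ≡⟨ cancel _ ⟩
  sign (m ℕ.+ (k ℕ.+ k))             ≡⟨ sign-+-double m k ⟩
  sign m                             ∎
  where
  open ≡-Reasoning
  cancel : ∀ a → -1ℤ *ℤ (-1ℤ *ℤ a) ≡ a
  cancel = solve-∀

-- The numbers n + k and n - k differ by the even number 2k.
sign-∸ : ∀ {n k} → k ≤ n → sign (n ℕ.+ k) ≡ sign (n ∸ k)
sign-∸ {n} {k} k≤n = begin
  sign (n ℕ.+ k)               ≡⟨ cong (λ m → sign (m ℕ.+ k)) (ℕ.m∸n+n≡m k≤n) ⟨
  sign (n ∸ k ℕ.+ k ℕ.+ k)     ≡⟨ cong sign (ℕ.+-assoc (n ∸ k) k k) ⟩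
  sign (n ∸ k ℕ.+ (k ℕ.+ k))   ≡⟨ sign-+-double (n ∸ k) k ⟩
  sign (n ∸ k)                 ∎
  where open ≡-Reasoning

sign≡-1^ : ∀ m → sign m ≡ -1ℤ ^ℤ m
sign≡-1^ zero    = refl
sign≡-1^ (suc m) = cong (-1ℤ *ℤ_) (sign≡-1^ m)

-- An element satisfying `P` adds 1 to the first count or to the second, hence 1 or -1 to the
-- difference. Using `¬?` for the second filter matches the definition of `odd?`.
length-filter-difference : ∀ {A : Set} {E P : Pred A 0ℓ} (E? : Decidable E) (P? : Decidable P) xs →
  + length (filter P? (filter E? xs)) -ℤ + length (filter P? (filter (¬? ∘ E?) xs)) ≡
  +Σ.⨁ xs (λ x → (if does (E? x) then 1ℤ else -1ℤ) *ℤ (if does (P? x) then 1ℤ else 0ℤ))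
length-filter-difference E? P? []       = refl
length-filter-difference E? P? (x ∷ xs) with does (E? x)
... | true  with does (P? x)
...   | true  = trans (ℤ.+-assoc 1ℤ (+ length (filter P? (filter E? xs)))
                               (ℤ.- + length (filter P? (filter (¬? ∘ E?) xs))))
                      (cong (λ z → 1ℤ ℤ.+ z) (length-filter-difference E? P? xs))
...   | false = trans (length-filter-difference E? P? xs) (sym (ℤ.+-identityˡ _))
length-filter-difference E? P? (x ∷ xs) | false with does (P? x)
...   | true  = trans (rearrange (+ length (filter P? (filter E? xs))) (+ length (filter P? (filter (¬? ∘ E?) xs))))
                      (cong (λ z → -1ℤ ℤ.+ z) (length-filter-difference E? P? xs))
  where
  rearrange : ∀ a b → a -ℤ (1ℤ ℤ.+ b) ≡ -1ℤ ℤ.+ (a -ℤ b)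
  rearrange = solve-∀
...   | false = trans (length-filter-difference E? P? xs) (sym (ℤ.+-identityˡ _))

count-even-odd : ∀ n k →
  + length (filter (λ π → rlm π ≟ k) (𝔖ᵉ n)) -ℤ + length (filter (λ π → rlm π ≟ k) (𝔖ᵒ n)) ≡ signedSum n (δ k)
count-even-odd n k = trans (length-filter-difference (even? ∘ inv) (λ π → rlm π ≟ k) (𝔖 n))
  (+Σ.⨁-cong (𝔖 n) λ π → cong (_*ℤ δ k (RLMv π)) (sym (sign-parity (inv π))))

corollary36 : ∀ (n : ℕ) → n ≥ 1 →
    ((∑[ π ← 𝔖 n ] ((-ₚ 1ₚ) ^ₚ inv π *ₚ 𝐱 (RLMv π)))
    ≈ₚ (∏[ i ∈ odds n ] var i) *ₚ (∏[ j ∈ evens n ] (var j -ₚ 1ₚ)))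
    × (∀ (k : ℕ) → 1 ≤ k → k ≤ n →
    (+ length (filter (λ π → rlm π ≟ k) (𝔖ᵉ n))) -ℤ (+ length (filter (λ π → rlm π ≟ k) (𝔖ᵒ n)))
    ≡ (-1ℤ ^ℤ (n ∸ k)) *ℤ (+ binomial ⌊ n /2⌋ (k ⊖ ⌈ n /2⌉)))
corollary36 n _ = ∑-sign-RLMv n , λ k _ k≤n →
  trans (count-even-odd n k) (trans (signedSum-δ n k)
    (cong (_*ℤ shiftedBinomial n k) (trans (sign-∸ k≤n) (sign≡-1^ (n ∸ k)))))
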